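{- Let $(X,\phi)$ be a ranked convex geometry with critical base $\Sigma$, and let $j\in X$. Let $\mathrm{pred}(j)=\{a\in X:\exists A\to j\in\Sigma,\ a\in A\}$ and let $\mathcal{H}_j$ be the hypergraph with vertex set $X\setminus\bigcap_{M\in j^{\nearrow}}M$ and edge set $\{X\setminus M: M\in j^{\nearrow}\}$. Then a set $A\subseteq X$ is a critical minimal generator of $j$ if and only if $A\in Tr(\mathcal{H}_j[\mathrm{pred}(j)])$.
   Context: $X$ is finite. A closure operator $\phi$ on $X$ is extensive, monotone and idempotent; $(X,\phi)$ is standard if $\phi(\emptyset)=\emptyset$ and $\phi(\{x\})\setminus\{x\}$ is closed for all $x$. A unit implicational base $\Sigma$ (implications $A\to b$, $A\subseteq X$, $b\in X$) is an implicational base of $(X,\phi)$ if its closed sets (sets $S$ with $A\not\subseteq S$ or $b\in S$ for each $A\to b\in\Sigma$) are exactly the closed sets of $\phi$. $\Sigma$ is ranked if there is $\rho:X\to\mathbb{N}$ with $\rho(a)=\rho(b)+1$ whenever $A\to b\in\Sigma$ and $a\in A$. A ranked convex geometry is a standard closure space admitting a ranked implicational base. $A$ is a minimal generator of $b$ if $b\in\phi(A)$ and $b\notin\phi(A\setminus\{x\})$ for all $x\in A$. The critical base is the unique irredundant implicational base all of whose implications $A\to b$ have $A$ a minimal generator of $b$; a minimal generator $A$ of $b$ is critical if $A\to b$ belongs to the critical base. For $j\in X$, $j^{\nearrow}$ is the set of inclusion-maximal closed sets not containing $j$. For a hypergraph $\mathcal{H}$ and $S\subseteq V(\mathcal{H})$,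 the induced hypergraph $\mathcal{H}[S]$ has vertex set $S$ and edge set $\{E\cap S: E\in\mathcal{E}(\mathcal{H})\}$; $Tr(\mathcal{H})$ is the set of inclusion-minimal vertex sets intersecting every edge. -}

module Defs where

open import Level using (0ℓ)
import Data.Bool.Properties as Bool
open import Data.Fin.Base using (Fin)
import Data.Fin.Properties as Fin
open import Data.Fin.Subset
open import Data.Fin.Subset.Properties using (_∈?_; anySubset?; x∈∁p⇒x∉p; p∩q⊆q)
open import Data.List.Base using (List; filter)
import Data.List.Membership.Propositional as List
import Data.List.Membership.DecPropositional as DecMembership
open import Data.Nat.Base using (ℕ; suc)
open import Data.Product.Base using (_×_; _,_; ∃-syntax; Σ-syntax)
import Data.Product.Properties as Product
open import Data.Sum.Base using (_⊎_)
import Data.Vec.Base as Vec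
import Data.Vec.Properties as Vec
open import Function.Bundles using (_⇔_)
open import Relation.Binary.Definitions using (DecidableEquality)
open import Relation.Binary.PropositionalEquality using (_≡_)
open import Relation.Nullary.Decidable using (does; ¬?; _×-dec_)
open import Relation.Nullary.Negation using (¬_)
open import Relation.Unary using (Pred; Decidable)

private
  variable
    n : ℕ

-- The ground set X is Fin n, and its subsets are the decidable ones, Subset n.

record IsClosureOperator (φ : Subset n → Subset n) : Set where
  field
    extensive  : ∀ S → S ⊆ φ S
    monotone   : ∀ {S T} → S ⊆ T → φ S ⊆ φ T
    idempotent : ∀ S → φ (φ S) ≡ φ S

Closed : (Subset n → Subset n) → Pred (Subset n) 0ℓ
Closed φ S = φ S ≡ S

record IsStandard (φ : Subset n → Subset n) : Set where
  field
    isClosureOperator : IsClosureOperator φ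
    φ-∅               : φ ⊥ ≡ ⊥
    φ-singleton       : ∀ x → Closed φ (φ ⁅ x ⁆ - x)

_↗[_] : Fin n → (Subset n → Subset n) → Pred (Subset n) 0ℓ
(j ↗[ φ ]) M =
  Closed φ M × j ∉ M × (∀ N → Closed φ N → j ∉ N → M ⊆ N → N ≡ M)

Implication : ℕ → Set
Implication n = Subset n × Fin n

-- A list of implications stands for the finite set of its members;
-- order and repetition are never observed.
Implications : ℕ → Set
Implications n = List (Implication n)

_≟ᴵ_ : DecidableEquality (Implication n)
_≟ᴵ_ = Product.≡-dec (Vec.≡-dec Bool._≟_) Fin._≟_

_∖_ : Implications n → Implication n → Implications n
Σ ∖ i = filter (λ i′ → ¬? (i′ ≟ᴵ i)) Σ

ClosedUnder : Implications n → Pred (Subset n) 0ℓ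
ClosedUnder Σ S = ∀ {A b} → (A , b) List.∈ Σ → A ⊈ S ⊎ b ∈ S

IsBase : (Subset n → Subset n) → Implications n → Set
IsBase φ Σ = ∀ S → ClosedUnder Σ S ⇔ Closed φ S

Ranked : Implications n → Set
Ranked {n} Σ =
  Σ[ ρ ∈ (Fin n → ℕ) ] (∀ {A b a} → (A , b) List.∈ Σ → a ∈ A → ρ a ≡ suc (ρ b))

record IsRankedConvexGeometry (φ : Subset n → Subset n) : Set where
  field
    isStandard : IsStandard φ
    rankedBase : ∃[ Σ ] (IsBase φ Σ × Ranked Σ)

IsMinimalGenerator : (Subset n → Subset n) → Subset n → Fin n → Set
IsMinimalGenerator φ A b = b ∈ φ A × (∀ {x} → x ∈ A → b ∉ φ (A - x))

-- The critical base is pinned down by these properties: in a ranked convex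
-- geometry exactly one set of implications has them.
record IsCriticalBase (φ : Subset n → Subset n) (Σ : Implications n) : Set where
  field
    isBase            : IsBase φ Σ
    irredundant       : ∀ {i} → i List.∈ Σ → ¬ IsBase φ (Σ ∖ i)
    minimalGenerators : ∀ {A b} → (A , b) List.∈ Σ → IsMinimalGenerator φ A b

-- Only meaningful when Σ is the critical base of φ.
IsCriticalMinimalGenerator :
  (Subset n → Subset n) → Implications n → Subset n → Fin n → Set
IsCriticalMinimalGenerator φ Σ A b =
  IsMinimalGenerator φ A b × (A , b) List.∈ Σ

comprehension : {P : Pred (Fin n) 0ℓ} → Decidable P → Subset n
comprehension P? = Vec.tabulate (λ x → does (P? x))

pred : Implications n → Fin n → Subset n
pred Σ j = comprehension λ a → anySubset? λ A → ((A , j) ∈ᴵ? Σ) ×-dec (a ∈? A)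
  where open DecMembership _≟ᴵ_ renaming (_∈?_ to _∈ᴵ?_)

record Hypergraph (n : ℕ) : Set₁ where
  field
    Vertex : Pred (Fin n) 0ℓ
    Edge   : Pred (Subset n) 0ℓ
    edge⊆  : ∀ {E} → Edge E → ∀ {x} → x ∈ E → Vertex x

open Hypergraph public

-- The definition makes sense for every S, so S ⊆ V(H) is not demanded.
_[_] : Hypergraph n → Subset n → Hypergraph n
(H [ S ]) .Vertex x = x ∈ S
(H [ S ]) .Edge F = ∃[ E ] (Edge H E × F ≡ E ∩ S)
(H [ S ]) .edge⊆ (E , _ , _≡_.refl) = p∩q⊆q E S

IsTransversal : Hypergraph n → Pred (Subset n) 0ℓ
IsTransversal H T =
  (∀ {x} → x ∈ T → Vertex H x) × (∀ {E} → Edge H E → Nonempty (T ∩ E))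

Tr : Hypergraph n → Pred (Subset n) 0ℓ
Tr H T = IsTransversal H T × (∀ {T′} → IsTransversal H T′ → T′ ⊆ T → T′ ≡ T)

𝓗 : (Subset n → Subset n) → Fin n → Hypergraph n
𝓗 φ j .Vertex x = ¬ (∀ {M} → (j ↗[ φ ]) M → x ∈ M)
𝓗 φ j .Edge E = ∃[ M ] ((j ↗[ φ ]) M × E ≡ ∁ M)
𝓗 φ j .edge⊆ (M , M∈j↗ , _≡_.refl) x∈∁M x∈⋂ = x∈∁p⇒x∉p x∈∁M (x∈⋂ M∈j↗)

{-# OPTIONS --safe #-}

-- A ranking of one base ranks the critical base Σ too.  If A → b is in Σ, the
-- minimality of A puts all its ranks above ρ b.  The ranked base also has some
-- B → b with B ⊆ φ A; a premise in A of rank above ρ b + 1 would make A → b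
-- redundant, because A → b is involved neither in deriving B from A (its
-- conclusion has too small a rank) nor b from B (its premise has too large a
-- rank).
--
-- A set T meets every X ∖ M with M ∈ j↗ iff j ∈ φ T, so Tr(𝓗_j[pred j])
-- consists of the minimal T ⊆ pred j with j ∈ φ T.  For such a T some A → j in
-- Σ has A ⊆ φ T.  As A and T both live on rank ρ j + 1 and elements of φ T ∖ T
-- have smaller rank than those of T, A ⊆ T and hence A = T.
module Submission where

open import Defs
import Data.Bool.Properties as Bool
open import Data.Fin.Base using (Fin)
import Data.Fin.Properties as Fin
open import Data.Fin.Subset
open import Data.Fin.Subset.Properties
open import Data.Fin.Subset.Induction using (⊃-wellFounded; Acc; acc)
import Data.List.Membership.Propositional as List
import Data.List.Membership.DecPropositional as DecMembership
open import Data.List.Membership.Propositional.Properties using (∈-filter⁺; ∈-filter⁻)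
open import Data.Nat.Base using (ℕ; suc) renaming (_≤_ to _≤ⁿ_; _<_ to _<ⁿ_)
import Data.Nat.Properties as ℕ
open import Data.Product.Base using (_×_; _,_; proj₁; proj₂; ∃-syntax)
open import Data.Sum.Base using (_⊎_; inj₁; inj₂)
import Data.Vec.Properties as Vec
open import Function.Base using (_∘_; id)
open import Function.Bundles using (_⇔_; mk⇔; module Equivalence)
open import Level using (0ℓ)
open import Relation.Binary.PropositionalEquality using (_≡_; _≢_; refl; sym; trans; subst)
open import Relation.Nullary.Decidable
  using (Dec; yes; no; does; ¬?; _×-dec_; _⊎-dec_; dec-true; decidable-stable)
open import Relation.Nullary.Negation using (¬_; contradiction)
open import Relation.Unary using (Pred; Decidable)

private
  variable
    n : ℕ
    φ : Subset n → Subset n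
    Γ Σ : Implications n
    ρ : Fin n → ℕ
    A S T : Subset n
    b j x : Fin n

-- Comprehension, and sets closed under implications.

module _ {P : Pred (Fin n) 0ℓ} (P? : Decidable P) where

  ∈-comprehension⁺ : P x → x ∈ comprehension P?
  ∈-comprehension⁺ {x} Px =
    Vec.lookup⇒[]= x _ (trans (Vec.lookup∘tabulate _ x) (dec-true (P? x) Px))

  ∈-comprehension⁻ : x ∈ comprehension P? → P x
  ∈-comprehension⁻ {x} x∈ =
    witness (P? x) (trans (sym (Vec.lookup∘tabulate _ x)) (Vec.[]=⇒lookup x∈))
    where
    witness : (d : Dec (P x)) → does d ≡ inside → P x
    witness (yes Px) _ = Px

_∈ᴵ?_ : (i : Implication n) (Γ : Implications n) → Dec (i List.∈ Γ)
_∈ᴵ?_ = DecMembership._∈?_ _≟ᴵ_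

closed? : (φ : Subset n → Subset n) → Decidable (Closed φ)
closed? φ S = Vec.≡-dec Bool._≟_ (φ S) S

closed-infers : ClosedUnder Γ S → (A , b) List.∈ Γ → A ⊆ S → b ∈ S
closed-infers closed A→b A⊆S with closed A→b
... | inj₁ A⊈S = contradiction (λ {_} → A⊆S) A⊈S
... | inj₂ b∈S = b∈S

closedUnder : (∀ {A b} → (A , b) List.∈ Γ → A ⊆ S → b ∈ S) → ClosedUnder Γ S
closedUnder {S = S} infers {A} {b} A→b with A ⊆? S
... | yes A⊆S = inj₂ (infers A→b A⊆S)
... | no  A⊈S = inj₁ A⊈S

-- Closure operators, their bases, and transversals.

module _ (isClosure : IsClosureOperator φ) where
  open IsClosureOperator isClosure

  closed-⊆ : Closed φ S → T ⊆ S → φ T ⊆ S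
  closed-⊆ φS≡S T⊆S x∈φT = subst (_ ∈_) φS≡S (monotone T⊆S x∈φT)

  φ-infers : IsBase φ Γ → (A , b) List.∈ Γ → A ⊆ φ T → b ∈ φ T
  φ-infers base = closed-infers (Equivalence.from (base _) (idempotent _))

  -- The elements satisfying `P` form a set closed under `Γ`, hence a closed set containing `T`.
  -- Decidability of `P` is what makes it a `Subset`.
  φ-induction : IsBase φ Γ → {P : Pred (Fin _) 0ℓ} → Decidable P →
    (∀ {x} → x ∈ T → P x) →
    (∀ {A b} → (A , b) List.∈ Γ → (∀ {a} → a ∈ A → P a) → P b) →
    ∀ {x} → x ∈ φ T → P x
  φ-induction base P? init step = ∈-comprehension⁻ P? ∘ closed-⊆
    (Equivalence.to (base _)
      (closedUnder λ A→b A⊆P → ∈-comprehension⁺ P? (step A→b (∈-comprehension⁻ P? ∘ A⊆P))))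
    (∈-comprehension⁺ P? ∘ init)

  -- If no such premise existed, `φ T` without `b` would still be closed under `Γ` and contain `T`.
  last-inference : IsBase φ Γ → b ∈ φ T → b ∉ T →
    ∃[ A ] ((A , b) List.∈ Γ × A ⊆ φ T)
  last-inference {Γ = Γ} {b = b} {T = T} base b∈φT b∉T
    with anySubset? (λ A → ((A , b) ∈ᴵ? Γ) ×-dec (A ⊆? φ T))
  ... | yes found = found
  ... | no  none  = contradiction refl (proj₂ (φ-induction base
    (λ x → (x ∈? φ T) ×-dec ¬? (x Fin.≟ b))
    (λ x∈T → extensive T x∈T , λ { refl → b∉T x∈T })
    (λ {A} A→d A⊆P →
      φ-infers base A→d (proj₁ ∘ A⊆P) , λ { refl → none (A , A→d , (proj₁ ∘ A⊆P)) })
    b∈φT))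

  ∃-maximal : Closed φ S → j ∉ S → ∃[ M ] ((j ↗[ φ ]) M × S ⊆ M)
  ∃-maximal = extend (⊃-wellFounded _)
    where
    extend : Acc _⊃_ S → Closed φ S → j ∉ S → ∃[ M ] ((j ↗[ φ ]) M × S ⊆ M)
    extend {S} {j} (acc rec) closed j∉S
      with anySubset? (λ N → closed? φ N ×-dec (¬? (j ∈? N) ×-dec (S ⊂? N)))
    ... | yes (N , closedN , j∉N , S⊂N)
        with M , M∈j↗ , N⊆M ← extend (rec S⊂N) closedN j∉N
        = M , M∈j↗ , N⊆M ∘ p⊂q⇒p⊆q S⊂N
    ... | no none = S , (closed , j∉S , maximal) , id
      where
      maximal : ∀ N → Closed φ N → j ∉ N → S ⊆ N → N ≡ S
      maximal N closedN j∉N S⊆N = ⊆-antisym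
        (λ {x} x∈N → decidable-stable (x ∈? S) λ x∉S →
          none (N , closedN , j∉N , S⊆N , x , x∈N , x∉S))
        S⊆N

  -- If `j` were outside `φ T`, a maximal closed set around `φ T` avoiding `j` would have a
  -- complement that `T` misses.
  transversal⇒∈φ : IsTransversal (𝓗 φ j [ S ]) T → j ∈ φ T
  transversal⇒∈φ {j = j} {S = S} {T = T} (_ , meets) = decidable-stable (j ∈? φ T) λ j∉φT →
    let M , M∈j↗ , φT⊆M = ∃-maximal (idempotent T) j∉φT
        x , x∈T∩E = meets (∁ M , (M , M∈j↗ , refl) , refl)
        x∈T , x∈E = x∈p∩q⁻ T (∁ M ∩ S) x∈T∩E
    in x∈∁p⇒x∉p (p∩q⊆p (∁ M) S x∈E) (φT⊆M (extensive T x∈T))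

  -- A closed set avoiding `j` cannot contain `T`. The element of `T` outside it lies in `S`, so
  -- cutting edges down to `S` loses nothing.
  ∈φ⇒transversal : T ⊆ S → j ∈ φ T → IsTransversal (𝓗 φ j [ S ]) T
  ∈φ⇒transversal {T = T} {S = S} {j = j} T⊆S j∈φT = T⊆S , meets
    where
    meets : ∀ {E} → Edge (𝓗 φ j [ S ]) E → Nonempty (T ∩ E)
    meets (_ , (M , (closed , j∉M , _) , refl) , refl) =
      decidable-stable (nonempty? _) λ disjoint →
        j∉M (closed-⊆ closed (λ {x} x∈T → decidable-stable (x ∈? M) λ x∉M →
          disjoint (x , x∈p∩q⁺ (x∈T , x∈p∩q⁺ (x∉p⇒x∈∁p x∉M , T⊆S x∈T)))) j∈φT)

  minimalGenerator-least : IsMinimalGenerator φ A b → T ⊆ A → b ∈ φ T → T ≡ A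
  minimalGenerator-least {T = T} (_ , minimal) T⊆A b∈φT = ⊆-antisym T⊆A λ {x} x∈A →
    decidable-stable (x ∈? T) λ x∉T → minimal x∈A
      (monotone (λ y∈T → x∈p∧x≢y⇒x∈p-y (T⊆A y∈T) λ { refl → x∉T y∈T }) b∈φT)

-- Closure and minimal generators when ranks drop along a base.

Decreasing : (Fin n → ℕ) → Implications n → Set
Decreasing ρ Γ = ∀ {A b a} → (A , b) List.∈ Γ → a ∈ A → ρ b <ⁿ ρ a

module _ (isStandard : IsStandard φ) (base : IsBase φ Γ) (decreasing : Decreasing ρ Γ) where
  open IsStandard isStandard
  open IsClosureOperator isClosureOperator

  -- An empty premise would put its conclusion into `φ ⊥`, which is empty in a standard space.
  premise-nonempty : (A , b) List.∈ Γ → Nonempty A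
  premise-nonempty {A} {b} A→b = decidable-stable (nonempty? A) λ empty →
    ∉⊥ (subst (b ∈_) φ-∅ (φ-infers isClosureOperator base A→b
      λ x∈A → contradiction (_ , x∈A) empty))

  -- Each inferred element ranks strictly below some premise, and there is one because premises are
  -- nonempty.
  φ-rank-bound : ∀ {k} → (∀ {x} → x ∈ T → ρ x ≤ⁿ k) → x ∈ φ T → x ∈ T ⊎ ρ x <ⁿ k
  φ-rank-bound {T = T} {k = k} bound = φ-induction isClosureOperator base
    (λ x → (x ∈? T) ⊎-dec (ρ x ℕ.<? k)) inj₁ step
    where
    bound′ : ∀ {x} → x ∈ T ⊎ ρ x <ⁿ k → ρ x ≤ⁿ k
    bound′ (inj₁ x∈T) = bound x∈T
    bound′ (inj₂ ρx<k) = ℕ.<⇒≤ ρx<k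
    step : ∀ {A b} → (A , b) List.∈ Γ → (∀ {a} → a ∈ A → a ∈ T ⊎ ρ a <ⁿ k) →
      b ∈ T ⊎ ρ b <ⁿ k
    step A→b A⊆P with a , a∈A ← premise-nonempty A→b =
      inj₂ (ℕ.<-≤-trans (decreasing A→b a∈A) (bound′ (A⊆P a∈A)))

  -- Deriving `b` uses only elements ranked above `b`, so a generator element of rank at most `ρ b`
  -- could be dropped.
  minimalGenerator-rank : IsMinimalGenerator φ A b → b ∉ A → ∀ {a} → a ∈ A → ρ b <ⁿ ρ a
  minimalGenerator-rank {A} {b} (b∈φA , minimal) b∉A {a} a∈A = ℕ.≰⇒> λ ρa≤ρb →
    minimal a∈A (drop (φ-induction isClosureOperator base P? (init ρa≤ρb) step b∈φA))
    where
    P : Pred (Fin _) 0ℓ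
    -- Low elements other than `b` are granted for free: they are never premises of an implication
    -- concluding at rank `ρ b` or more. Excluding `b` lets `drop` recover a genuine derivation from
    -- `A - a`.
    P x = x ∈ φ (A - a) ⊎ (ρ x ≤ⁿ ρ b × x ≢ b)
    P? : Decidable P
    P? x = (x ∈? φ (A - a)) ⊎-dec ((ρ x ℕ.≤? ρ b) ×-dec ¬? (x Fin.≟ b))
    init : ρ a ≤ⁿ ρ b → ∀ {x} → x ∈ A → P x
    init ρa≤ρb {x} x∈A with x Fin.≟ a
    ... | yes refl = inj₂ (ρa≤ρb , λ { refl → b∉A x∈A })
    ... | no x≢a = inj₁ (extensive _ (x∈p∧x≢y⇒x∈p-y x∈A x≢a))
    high : ∀ {x} → ρ b <ⁿ ρ x → P x → x ∈ φ (A - a)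
    high _ (inj₁ x∈φ) = x∈φ
    high ρb<ρx (inj₂ (ρx≤ρb , _)) = contradiction ρx≤ρb (ℕ.<⇒≱ ρb<ρx)
    infer : ∀ {C d} → (C , d) List.∈ Γ → ρ b ≤ⁿ ρ d → (∀ {c} → c ∈ C → P c) → d ∈ φ (A - a)
    infer C→d ρb≤ρd C⊆P = φ-infers isClosureOperator base C→d λ c∈C →
      high (ℕ.≤-<-trans ρb≤ρd (decreasing C→d c∈C)) (C⊆P c∈C)
    step : ∀ {C d} → (C , d) List.∈ Γ → (∀ {c} → c ∈ C → P c) → P d
    step {d = d} C→d C⊆P with ρ b ℕ.≤? ρ d | d Fin.≟ b
    ... | yes ρb≤ρd | _ = inj₁ (infer C→d ρb≤ρd C⊆P)
    ... | no ρb≰ρd | no d≢b = inj₂ (ℕ.≰⇒≥ ρb≰ρd , d≢b)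
    ... | no ρb≰ρd | yes refl = contradiction ℕ.≤-refl ρb≰ρd
    drop : P b → b ∈ φ (A - a)
    drop (inj₁ b∈φ) = b∈φ
    drop (inj₂ (_ , b≢b)) = contradiction refl b≢b

ranked⇒decreasing : (∀ {A b a} → (A , b) List.∈ Γ → a ∈ A → ρ a ≡ suc (ρ b)) → Decreasing ρ Γ
ranked⇒decreasing ranked A→b a∈A = ℕ.≤-reflexive (sym (ranked A→b a∈A))

isPremise? : (Σ : Implications n) (j : Fin n) →
  Decidable (λ a → ∃[ A ] ((A , j) List.∈ Σ × a ∈ A))
isPremise? Σ j a = anySubset? λ A → ((A , j) ∈ᴵ? Σ) ×-dec (a ∈? A)

∈-pred⁺ : ∀ (Σ : Implications n) j → (A , j) List.∈ Σ → A ⊆ pred Σ j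
∈-pred⁺ Σ j A→j a∈A = ∈-comprehension⁺ (isPremise? Σ j) (_ , A→j , a∈A)

∈-pred⁻ : ∀ (Σ : Implications n) j → x ∈ pred Σ j → ∃[ A ] ((A , j) List.∈ Σ × x ∈ A)
∈-pred⁻ Σ j = ∈-comprehension⁻ (isPremise? Σ j)

-- Ranks in the critical base.

module _ {Σ : Implications n} (isCritical : IsCriticalBase φ Σ) where
  open IsCriticalBase isCritical

  -- Irredundance in usable form: were `A → b` respected by every set closed under the other
  -- implications, these would already form a base.
  critical-needed : (A , b) List.∈ Σ →
    ¬ (∀ {S} → ClosedUnder (Σ ∖ (A , b)) S → A ⊆ S → b ∈ S)
  critical-needed {A} {b} A→b derivable = irredundant A→b λ S → mk⇔ to from
    where
    infers : ∀ {S C d} → ClosedUnder (Σ ∖ (A , b)) S → (C , d) List.∈ Σ → C ⊆ S → d ∈ S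
    infers {C = C} {d} closed C→d C⊆S with (C , d) ≟ᴵ (A , b)
    ... | yes refl = derivable (λ {_} {_} → closed) C⊆S
    ... | no ≢ = closed-infers closed (∈-filter⁺ _ C→d ≢) C⊆S
    to : ∀ {S} → ClosedUnder (Σ ∖ (A , b)) S → Closed φ S
    to {S} closed = Equivalence.to (isBase S) (closedUnder (infers {S} closed))
    from : ∀ {S} → Closed φ S → ClosedUnder (Σ ∖ (A , b)) S
    from {S} closed C→d = Equivalence.from (isBase S) closed (proj₁ (∈-filter⁻ _ C→d))

  critical-irreflexive : (A , b) List.∈ Σ → b ∉ A
  critical-irreflexive A→b b∈A = critical-needed A→b λ _ A⊆S → A⊆S b∈A

  module _ (isStandard : IsStandard φ) (base : IsBase φ Γ)
    (ranked : ∀ {A b a} → (A , b) List.∈ Γ → a ∈ A → ρ a ≡ suc (ρ b)) where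
    open IsStandard isStandard
    open IsClosureOperator isClosureOperator

    -- The lower half of the ranking, proved first because the upper half needs ranks to drop along
    -- `Σ`.
    critical-decreasing : Decreasing ρ Σ
    critical-decreasing A→b = minimalGenerator-rank isStandard base (ranked⇒decreasing ranked)
      (minimalGenerators A→b) (critical-irreflexive A→b)

    critical-ranked : ∀ {a} → (A , b) List.∈ Σ → a ∈ A → ρ a ≡ suc (ρ b)
    critical-ranked {A} {b} {a} A→b a∈A =
      ℕ.≤-antisym (ℕ.≮⇒≥ λ high → critical-needed A→b (derivable high))
        (critical-decreasing A→b a∈A)
      where
      derivable : suc (ρ b) <ⁿ ρ a → ClosedUnder (Σ ∖ (A , b)) S → A ⊆ S → b ∈ S
      derivable {S} high closed A⊆S
        with B , B→b , B⊆φA ← last-inference isClosureOperator base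
               (proj₁ (minimalGenerators A→b)) (critical-irreflexive A→b)
        -- Membership in `φ B` is carried along with membership in `S`, since it caps the ranks that
        -- can occur.
        = φ-induction isClosureOperator isBase (λ x → (x ∈? S) ×-dec (x ∈? φ B))
            (λ x∈B → B⊆S x∈B , extensive B x∈B) from-B
            (φ-infers isClosureOperator base B→b (extensive B)) .proj₁
        where
        -- Membership in `S` is demanded only above rank `ρ b`. The omitted `A → b` concludes at
        -- rank `ρ b` itself and so falls into the free case.
        from-A : ∀ {C d} → (C , d) List.∈ Σ →
          (∀ {c} → c ∈ C → c ∈ S ⊎ ρ c ≤ⁿ ρ b) → d ∈ S ⊎ ρ d ≤ⁿ ρ b
        from-A {C} {d} C→d C⊆P with ρ d ℕ.≤? ρ b
        ... | yes ρd≤ρb = inj₂ ρd≤ρb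
        ... | no ρd≰ρb = inj₁ (closed-infers closed
          (∈-filter⁺ _ C→d λ { refl → ρd≰ρb ℕ.≤-refl }) C⊆S)
          where
          C⊆S : C ⊆ S
          C⊆S c∈C with C⊆P c∈C
          ... | inj₁ c∈S = c∈S
          ... | inj₂ ρc≤ρb = contradiction
            (ℕ.≤-trans (ℕ.<⇒≤ (critical-decreasing C→d c∈C)) ρc≤ρb) ρd≰ρb
        B⊆S : B ⊆ S
        B⊆S x∈B with φ-induction isClosureOperator isBase
                      (λ x → (x ∈? S) ⊎-dec (ρ x ℕ.≤? ρ b)) (inj₁ ∘ A⊆S) from-A (B⊆φA x∈B)
        ... | inj₁ x∈S = x∈S
        ... | inj₂ ρx≤ρb = contradiction ρx≤ρb
          (ℕ.<⇒≱ (ranked⇒decreasing ranked B→b x∈B))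
        φB-low : ∀ {x} → x ∈ φ B → ρ x ≤ⁿ suc (ρ b)
        φB-low x∈φB with φ-rank-bound isStandard base (ranked⇒decreasing ranked)
                           (λ y∈B → ℕ.≤-reflexive (ranked B→b y∈B)) x∈φB
        ... | inj₁ x∈B = ℕ.≤-reflexive (ranked B→b x∈B)
        ... | inj₂ ρx< = ℕ.<⇒≤ ρx<
        from-B : ∀ {C d} → (C , d) List.∈ Σ →
          (∀ {c} → c ∈ C → c ∈ S × c ∈ φ B) → d ∈ S × d ∈ φ B
        from-B C→d C⊆P =
          closed-infers closed
            -- Using `A → b` here would place `a`, ranked above `suc (ρ b)`, inside `φ B`.
            (∈-filter⁺ _ C→d λ { refl → ℕ.<⇒≱ high (φB-low (proj₂ (C⊆P a∈A))) })
            (proj₁ ∘ C⊆P) ,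
          φ-infers isClosureOperator isBase C→d (proj₂ ∘ C⊆P)

    ∈-pred-rank : x ∈ pred Σ j → ρ x ≡ suc (ρ j)
    ∈-pred-rank {j = j} x∈pred =
      let _ , B→j , x∈B = ∈-pred⁻ Σ j x∈pred in critical-ranked B→j x∈B

    critical-⊆ : (A , j) List.∈ Σ → (∀ {x} → x ∈ T → ρ x ≡ suc (ρ j)) → A ⊆ φ T → A ⊆ T
    critical-⊆ A→j T-rank A⊆φT x∈A
      with φ-rank-bound isStandard base (ranked⇒decreasing ranked)
             (ℕ.≤-reflexive ∘ T-rank) (A⊆φT x∈A)
    ... | inj₁ x∈T = x∈T
    ... | inj₂ ρx< = contradiction (critical-ranked A→j x∈A) (ℕ.<⇒≢ ρx<)

theorem5 : ∀ {n : ℕ} {φ : Subset n → Subset n} {Σ : Implications n} →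
    IsRankedConvexGeometry φ →
    IsCriticalBase φ Σ →
    ∀ (j : Fin n) (A : Subset n) →
    IsCriticalMinimalGenerator φ Σ A j ⇔ Tr (𝓗 φ j [ pred Σ j ]) A
theorem5 {φ = φ} {Σ} geometry critical j T = mk⇔ to from
  where
  open IsRankedConvexGeometry geometry
  open IsStandard isStandard
  open IsCriticalBase critical

  to : IsCriticalMinimalGenerator φ Σ T j → Tr (𝓗 φ j [ pred Σ j ]) T
  to (generator , T→j) =
    ∈φ⇒transversal isClosureOperator (∈-pred⁺ Σ j T→j) (proj₁ generator) ,
    λ transversal T′⊆T → minimalGenerator-least isClosureOperator generator T′⊆T
      (transversal⇒∈φ isClosureOperator transversal)

  from : Tr (𝓗 φ j [ pred Σ j ]) T → IsCriticalMinimalGenerator φ Σ T j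
  from (transversal , minimal) =
    let Γ , base , ρ , ranked = rankedBase
        A , A→j , A⊆φT = last-inference isClosureOperator isBase
          (transversal⇒∈φ isClosureOperator transversal)
          -- As `T` lies in `pred Σ j`, having `j` in `T` would make `j` a premise of an implication
          -- concluding `j`.
          (λ j∈T → let _ , B→j , j∈B = ∈-pred⁻ Σ j (proj₁ transversal j∈T)
                   in critical-irreflexive critical B→j j∈B)
        -- `A` is itself a transversal contained in `T`, so minimality of `T` forces equality.
        A≡T = minimal
          (∈φ⇒transversal isClosureOperator (∈-pred⁺ Σ j A→j) (proj₁ (minimalGenerators A→j)))
          (critical-⊆ critical isStandard base ranked A→j
            (∈-pred-rank critical isStandard base ranked ∘ proj₁ transversal) A⊆φT)
    in subst (λ S → IsCriticalMinimalGenerator φ Σ S j) A≡T (minimalGenerators A→j , A→j)
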